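{- Let $n,k$ be positive integers with $n>\binom{k+1}{2}$ and let $\mathcal{F}\subseteq[n]^{(k)}$ be intersecting. Then there exists an $i\in[n]$ such that $\vert\partial(\mathcal{F}(i))\vert\geq\vert\mathcal{F}(i)\vert$.
   Context: $[n]=\{1,\dots,n\}$ and $X^{(k)}$ denotes the set of $k$-element subsets of $X$. A family $\mathcal{F}$ is intersecting if $F\cap F'\neq\emptyset$ for all $F,F'\in\mathcal{F}$. The shadow of a family $\mathcal{H}$ is $\partial\mathcal{H}=\{H\setminus\{x\}: x\in H\in\mathcal{H}\}$. For $i\in[n]$, the link is $\mathcal{F}(i)=\{F\setminus\{i\}: i\in F\in\mathcal{F}\}$. -}

module Defs where

open import Data.Nat using (ℕ; zero; suc)
open import Data.Bool using (Bool; true; false; _∧_; T)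
import Data.Bool as B
open import Data.List using (List; []; _∷_; _++_; map; filter; length)
open import Data.Bool.ListAction using (any)
open import Data.Fin using (Fin)
open import Data.Fin.Subset using (Subset; inside; outside; _∩_; _-_; ∣_∣; Nonempty)
open import Data.Fin.Subset.Properties using (_∈?_)
open import Data.Vec using (Vec; []; _∷_)
open import Data.Vec.Properties using (≡-dec)
open import Data.List using (allFin)
open import Relation.Nullary.Decidable using (⌊_⌋; T?)
open import Relation.Binary.PropositionalEquality using (_≡_)

Family : ℕ → Set
Family n = Subset n → Bool

allSubsets : (n : ℕ) → List (Subset n)
allSubsets zero    = [] ∷ []
allSubsets (suc n) = map (inside ∷_) (allSubsets n) ++ map (outside ∷_) (allSubsets n)

card : ∀ {n} → Family n → ℕ
card {n} 𝓕 = length (filter (λ p → T? (𝓕 p)) (allSubsets n))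

_∈𝓕_ : ∀ {n} → Subset n → Family n → Set
p ∈𝓕 𝓕 = T (𝓕 p)

eqS : ∀ {n} → Subset n → Subset n → Bool
eqS p q = ⌊ ≡-dec B._≟_ p q ⌋

mem : ∀ {n} → Fin n → Subset n → Bool
mem x p = ⌊ x ∈? p ⌋

Uniform : ∀ {n} → ℕ → Family n → Set
Uniform k 𝓕 = ∀ p → p ∈𝓕 𝓕 → ∣ p ∣ ≡ k

Intersecting : ∀ {n} → Family n → Set
Intersecting 𝓕 = ∀ p q → p ∈𝓕 𝓕 → q ∈𝓕 𝓕 → Nonempty (p ∩ q)

link : ∀ {n} → Family n → Fin n → Family n
link {n} 𝓕 i G = any (λ F → 𝓕 F ∧ mem i F ∧ eqS G (F - i)) (allSubsets n)

shadow : ∀ {n} → Family n → Family n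
shadow {n} 𝓗 G =
  any (λ H → any (λ x → 𝓗 H ∧ mem x H ∧ eqS G (H - x)) (allFin n)) (allSubsets n)

{-# OPTIONS --safe #-}

-- Call a family bad if its shadow is smaller than itself.  Two cross-intersecting
-- families are never both bad: shifting preserves the hypothesis and badness, and
-- a shifted bad family has a member whose walk never reaches height 1, which
-- yields disjoint members of the two families.
--
-- Suppose all links of 𝓕 are bad.  Call A ⊆ S a bad atom of S if the subfamily
-- { G ∈ 𝓕 : G ∩ S = A } is bad for the shadow that only removes elements outside
-- S.  Passing from S to a larger set splits an atom and leaves some part bad, and
-- any two bad atoms of S meet.  Every S with |S| > C(j,2) has a bad atom of size
-- at least j: if A is one of size exactly j and |S| > C(j+1,2), then
-- |S ∖ A| > C(j,2), so S ∖ A has a bad atom of size at least j, and an extension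
-- of it to S must also meet A.  For S = [n] and j = k+1 this is absurd.
module Submission where

open import Defs
open import Data.Nat using (ℕ; zero; suc; _+_; _*_; _≤_; _<_; _≥_; _>_; z≤n; s≤s; _<?_; _≤?_)
open import Data.Nat.Properties
open import Data.Nat.Combinatorics using (_C_; nC1≡n; nCk+nC[k+1]≡[n+1]C[k+1])
open import Data.Nat.Tactic.RingSolver using (solve-∀)
open import Data.Bool using (Bool; true; false; _∧_; _∨_; T)
import Data.Bool as Bool
open import Data.Bool.ListAction using (any)
open import Data.Bool.Properties using (T-∨; T-∧)
open import Data.Fin using (Fin; zero; suc)
import Data.Fin.Properties as Fin
open import Data.Fin.Subset
  using (Subset; ⊥; ⊤; ⁅_⁆; ∁; _∩_; _─_; _-_; ∣_∣; _∈_; _∉_; _⊆_; Nonempty; Empty)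
open import Data.Fin.Subset.Properties
open import Data.List using (List; []; _∷_; map; filter; length; allFin)
open import Data.List.Properties using (filter-++; length-++)
import Data.List.Membership.Propositional as List
open import Data.List.Membership.Propositional.Properties using (∈-++⁺ˡ; ∈-++⁺ʳ; ∈-map⁺; ∈-allFin)
open import Data.List.Relation.Unary.Any using (here; satisfied)
open import Data.List.Relation.Unary.Any.Properties using (any⁺; any⁻)
open import Data.Vec using ([]; _∷_; here; there)
open import Data.Vec.Properties using (≡-dec; ∷-injective)
open import Data.Product using (∃; ∃₂; _×_; _,_; proj₁; proj₂)
open import Data.Sum using (_⊎_; inj₁; inj₂; [_,_])
import Data.Sum as Sum
import Data.Empty as Empty
open import Data.Unit using (tt)
import Data.Unit as Unit
open import Function using (_∘_; id)
open import Function.Bundles using (module Equivalence)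
open import Relation.Nullary using (¬_; yes; no; contradiction)
open import Relation.Nullary.Decidable using (T?; toWitness; fromWitness)
open import Relation.Binary.PropositionalEquality
  using (_≡_; refl; sym; trans; cong; cong₂; subst; subst₂)
open ≤-Reasoning

-- Boolean connectives read as logical ones.

∨⁻ : ∀ {x y} → T (x ∨ y) → T x ⊎ T y
∨⁻ = Equivalence.to T-∨

∨⁺ : ∀ {x y} → T x ⊎ T y → T (x ∨ y)
∨⁺ = Equivalence.from T-∨

∧⁻ : ∀ {x y} → T (x ∧ y) → T x × T y
∧⁻ = Equivalence.to T-∧

∧⁺ : ∀ {x y} → T x × T y → T (x ∧ y)
∧⁺ = Equivalence.from T-∧

-- Families on the cube, split by the first coordinate, and their sizes.

infixl 8 _⊳_
infix 4 _⊑_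
infixr 6 _∩ᶠ_
infixr 5 _∪ᶠ_

_⊳_ : ∀ {n} → Family (suc n) → Bool → Family n
(A ⊳ b) p = A (b ∷ p)

_∩ᶠ_ _∪ᶠ_ : ∀ {n} → Family n → Family n → Family n
(A ∩ᶠ B) p = A p ∧ B p
(A ∪ᶠ B) p = A p ∨ B p

_⊑_ : ∀ {n} → Family n → Family n → Set
A ⊑ B = ∀ p → T (A p) → T (B p)

bit : Bool → ℕ
bit true  = 1
bit false = 0

-- Arbitrary weights are allowed, not only 0 and 1, so that the two values of a coordinate can later
-- be merged by `both`.
total : ∀ {n} → (Subset n → ℕ) → ℕ
total {zero}  φ = φ []
total {suc n} φ = total (λ p → φ (true ∷ p)) + total (λ p → φ (false ∷ p))

size : ∀ {n} → Family n → ℕ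
size A = total (λ p → bit (A p))

bit-mono : ∀ x y → (T x → T y) → bit x ≤ bit y
bit-mono false y     h = z≤n
bit-mono true  true  h = ≤-refl
bit-mono true  false h = Empty.⊥-elim (h tt)

total-mono : ∀ {n} (φ ψ : Subset n → ℕ) → (∀ p → φ p ≤ ψ p) → total φ ≤ total ψ
total-mono {zero}  φ ψ h = h []
total-mono {suc n} φ ψ h =
  +-mono-≤ (total-mono _ _ (λ p → h (true ∷ p))) (total-mono _ _ (λ p → h (false ∷ p)))

size-mono : ∀ {n} (A B : Family n) → A ⊑ B → size A ≤ size B
size-mono A B h = total-mono _ _ (λ p → bit-mono (A p) (B p) (h p))

+-interchange : ∀ a b c d → (a + b) + (c + d) ≡ (a + c) + (b + d)
+-interchange = solve-∀

total-+ : ∀ {n} (φ ψ : Subset n → ℕ) → total (λ p → φ p + ψ p) ≡ total φ + total ψ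
total-+ {zero}  φ ψ = refl
total-+ {suc n} φ ψ = trans
  (cong₂ _+_ (total-+ (φ ∘ (true ∷_)) (ψ ∘ (true ∷_))) (total-+ (φ ∘ (false ∷_)) (ψ ∘ (false ∷_))))
  (+-interchange (total (φ ∘ (true ∷_))) _ _ _)

size-∪∩ : ∀ {n} (A B : Family n) → size (A ∪ᶠ B) + size (A ∩ᶠ B) ≡ size A + size B
size-∪∩ {zero} A B with A [] | B []
... | true  | true  = refl
... | true  | false = refl
... | false | true  = refl
... | false | false = refl
size-∪∩ {suc n} A B =
  trans (+-interchange (size (A₁ ∪ᶠ B₁)) _ (size (A₁ ∩ᶠ B₁)) _)
    (trans (cong₂ _+_ (size-∪∩ A₁ B₁) (size-∪∩ (A ⊳ false) (B ⊳ false)))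
      (+-interchange (size A₁) _ _ _))
  where A₁ = A ⊳ true
        B₁ = B ⊳ true

-- Shadows.

-- Off S, only elements outside S are removed; then the sets with a prescribed
-- trace on S form a family closed under this shadow.
shadowOff : ∀ {n} → Subset n → Family n → Family n
shadowOff []          A []          = false
shadowOff (true  ∷ S) A (b ∷ p)     = shadowOff S (A ⊳ b) p
shadowOff (false ∷ S) A (true ∷ p)  = shadowOff S (A ⊳ true) p
shadowOff (false ∷ S) A (false ∷ p) = A (true ∷ p) ∨ shadowOff S (A ⊳ false) p

∂ : ∀ {n} → Family n → Family n
∂ = shadowOff ⊥

shadowOff-mono : ∀ {n} (S : Subset n) (A B : Family n) → A ⊑ B → shadowOff S A ⊑ shadowOff S B
shadowOff-mono []          A B h []          = id
shadowOff-mono (true  ∷ S) A B h (b ∷ p)     = shadowOff-mono S _ _ (λ q → h (b ∷ q)) p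
shadowOff-mono (false ∷ S) A B h (true ∷ p)  = shadowOff-mono S _ _ (λ q → h (true ∷ q)) p
shadowOff-mono (false ∷ S) A B h (false ∷ p) =
  ∨⁺ ∘ Sum.map (h (true ∷ p)) (shadowOff-mono S _ _ (λ q → h (false ∷ q)) p) ∘ ∨⁻

∂-mono : ∀ {n} (A B : Family n) → A ⊑ B → ∂ A ⊑ ∂ B
∂-mono = shadowOff-mono ⊥

∂-∪ : ∀ {n} (A B : Family n) → ∂ (A ∪ᶠ B) ⊑ ∂ A ∪ᶠ ∂ B
∂-∪ {suc n} A B (true ∷ p) h = ∂-∪ (A ⊳ true) (B ⊳ true) p h
∂-∪ {suc n} A B (false ∷ p) h with ∨⁻ {A (true ∷ p) ∨ B (true ∷ p)} h
... | inj₁ k = ∨⁺ {∂ A (false ∷ p)} {∂ B (false ∷ p)} (Sum.map (∨⁺ ∘ inj₁) (∨⁺ ∘ inj₁) (∨⁻ {A (true ∷ p)} k))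
... | inj₂ k = ∨⁺ {∂ A (false ∷ p)} {∂ B (false ∷ p)}
  (Sum.map (∨⁺ {A (true ∷ p)} ∘ inj₂) (∨⁺ {B (true ∷ p)} ∘ inj₂)
    (∨⁻ (∂-∪ (A ⊳ false) (B ⊳ false) p k)))

-- Cross-intersection and shifting.

Meets : ∀ {n} → Subset n → Subset n → Set
Meets []      []      = Empty.⊥
Meets (a ∷ p) (b ∷ q) = T (a ∧ b) ⊎ Meets p q

Meets-sym : ∀ {n} (p q : Subset n) → Meets p q → Meets q p
Meets-sym []      []      = id
Meets-sym (a ∷ p) (b ∷ q) = Sum.map (λ h → ∧⁺ (proj₂ (∧⁻ {a} h) , proj₁ (∧⁻ {a} h))) (Meets-sym p q)

¬Meets-⊥ : ∀ {n} (p : Subset n) → ¬ Meets p ⊥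
¬Meets-⊥ (a ∷ p) (inj₁ h) = proj₂ (∧⁻ {a} h)
¬Meets-⊥ (a ∷ p) (inj₂ h) = ¬Meets-⊥ p h

Cross : ∀ {n} → Family n → Family n → Set
Cross A B = ∀ p q → T (A p) → T (B q) → Meets p q

-- The compression that exchanges coordinate `j + 1` for the adjacent coordinate `j`. With `U` and
-- `V` the blocks of sets beginning with 10 and 01 at these places, it replaces `U` by their union
-- and `V` by their intersection.
shift : ∀ {n} → ℕ → Family n → Family n
shift zero    A []                  = A []
shift zero    A (b ∷ [])            = A (b ∷ [])
shift zero    A (true  ∷ false ∷ p) = A (true ∷ false ∷ p) ∨ A (false ∷ true ∷ p)
shift zero    A (false ∷ true  ∷ p) = A (true ∷ false ∷ p) ∧ A (false ∷ true ∷ p)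
shift zero    A (true  ∷ true  ∷ p) = A (true ∷ true ∷ p)
shift zero    A (false ∷ false ∷ p) = A (false ∷ false ∷ p)
shift (suc j) A []                  = A []
shift (suc j) A (b ∷ p)             = shift j (A ⊳ b) p

size-shift : ∀ {n} j (A : Family n) → size (shift j A) ≡ size A
size-shift {zero}        zero    A = refl
size-shift {suc zero}    zero    A = refl
size-shift {suc (suc n)} zero    A =
  trans (lem (size (A ⊳ true ⊳ true)) (size (U ∪ᶠ V)) (size (U ∩ᶠ V)) (size (A ⊳ false ⊳ false)))
    (trans (cong (λ z → size (A ⊳ true ⊳ true) + z + size (A ⊳ false ⊳ false)) (size-∪∩ U V))
      (sym (lem (size (A ⊳ true ⊳ true)) (size U) (size V) (size (A ⊳ false ⊳ false)))))
  where
  U = A ⊳ true ⊳ false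
  V = A ⊳ false ⊳ true
  lem : ∀ a b c d → (a + b) + (c + d) ≡ a + (b + c) + d
  lem = solve-∀
size-shift {zero}        (suc j) A = refl
size-shift {suc n}       (suc j) A = cong₂ _+_ (size-shift j (A ⊳ true)) (size-shift j (A ⊳ false))

shift-mono : ∀ {n} j (A B : Family n) → A ⊑ B → shift j A ⊑ shift j B
shift-mono zero    A B h []                  = h []
shift-mono zero    A B h (b ∷ [])            = h (b ∷ [])
shift-mono zero    A B h (true  ∷ true  ∷ p) = h _
shift-mono zero    A B h (true  ∷ false ∷ p) = ∨⁺ ∘ Sum.map (h _) (h _) ∘ ∨⁻
shift-mono zero    A B h (false ∷ true  ∷ p) x =
  ∧⁺ (h _ (proj₁ (∧⁻ {A (true ∷ false ∷ p)} x)) , h _ (proj₂ (∧⁻ {A (true ∷ false ∷ p)} x)))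
shift-mono zero    A B h (false ∷ false ∷ p) = h _
shift-mono (suc j) A B h []                  = h []
shift-mono (suc j) A B h (b ∷ p)             = shift-mono j _ _ (λ q → h (b ∷ q)) p

-- The shadow of a union lies in the union of the shadows, and that of an intersection in the
-- intersection of the shadows; this settles the two blocks that change.
∂-shift : ∀ {n} j (A : Family n) → ∂ (shift j A) ⊑ shift j (∂ A)
∂-shift zero A (true ∷ []) h = h
∂-shift zero A (false ∷ []) h = h
∂-shift zero A (true ∷ true ∷ p) h = h
∂-shift zero A (true ∷ false ∷ p) h with ∨⁻ {A (true ∷ true ∷ p)} h
... | inj₁ k = ∨⁺ (inj₁ (∨⁺ (inj₁ k)))
... | inj₂ k = ∨⁺ (Sum.map (∨⁺ {A (true ∷ true ∷ p)} ∘ inj₂) (∨⁺ {A (true ∷ true ∷ p)} ∘ inj₂)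
                 (∨⁻ (∂-∪ (A ⊳ true ⊳ false) (A ⊳ false ⊳ true) p k)))
∂-shift zero A (false ∷ true ∷ p) h with ∨⁻ {A (true ∷ true ∷ p)} h
... | inj₁ k = ∧⁺ (∨⁺ (inj₁ k) , ∨⁺ (inj₁ k))
... | inj₂ k = ∧⁺ (∨⁺ {A (true ∷ true ∷ p)} (inj₂ (∂-mono (U ∩ᶠ V) U (λ q → proj₁ ∘ ∧⁻) p k))
                 , ∨⁺ {A (true ∷ true ∷ p)} (inj₂ (∂-mono (U ∩ᶠ V) V (λ q → proj₂ ∘ ∧⁻ {U q}) p k)))
  where U = A ⊳ true ⊳ false
        V = A ⊳ false ⊳ true
∂-shift zero A (false ∷ false ∷ p) h with ∨⁻ {A (true ∷ false ∷ p) ∨ A (false ∷ true ∷ p)} h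
... | inj₂ k with ∨⁻ {A (true ∷ false ∷ p) ∧ A (false ∷ true ∷ p)} k
...   | inj₁ l = ∨⁺ {A (true ∷ false ∷ p)} (inj₁ (proj₁ (∧⁻ l)))
...   | inj₂ l = ∨⁺ {A (true ∷ false ∷ p)} (inj₂ (∨⁺ {A (false ∷ true ∷ p)} (inj₂ l)))
∂-shift zero A (false ∷ false ∷ p) h | inj₁ k with ∨⁻ {A (true ∷ false ∷ p)} k
...   | inj₁ l = ∨⁺ (inj₁ l)
...   | inj₂ l = ∨⁺ {A (true ∷ false ∷ p)} (inj₂ (∨⁺ (inj₁ l)))
∂-shift (suc j) A (true ∷ p) h = ∂-shift j (A ⊳ true) p h
∂-shift (suc j) A (false ∷ p) h with ∨⁻ {shift j (A ⊳ true) p} h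
... | inj₁ k = shift-mono j (A ⊳ true) (∂ A ⊳ false) (λ q → ∨⁺ ∘ inj₁) p k
... | inj₂ k = shift-mono j (∂ (A ⊳ false)) (∂ A ⊳ false) (λ q → ∨⁺ {A (true ∷ q)} ∘ inj₂) p
                 (∂-shift j (A ⊳ false) p k)

Cross-shift : ∀ {n} j (A B : Family n) → Cross A B → Cross (shift j A) (shift j B)
Cross-shift zero A B h [] [] x y = h [] [] x y
Cross-shift zero A B h (a ∷ []) (b ∷ []) x y = h (a ∷ []) (b ∷ []) x y
Cross-shift zero A B h (true ∷ a ∷ p) (true ∷ b ∷ q) x y = inj₁ tt
Cross-shift zero A B h (a ∷ true ∷ p) (b ∷ true ∷ q) x y = inj₂ (inj₁ tt)
Cross-shift zero A B h (true ∷ true ∷ p) (false ∷ false ∷ q) x y = h _ _ x y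
Cross-shift zero A B h (false ∷ false ∷ p) (true ∷ true ∷ q) x y = h _ _ x y
Cross-shift zero A B h (false ∷ false ∷ p) (false ∷ false ∷ q) x y = h _ _ x y
Cross-shift zero A B h (true ∷ false ∷ p) (false ∷ true ∷ q) x y with ∨⁻ {A (true ∷ false ∷ p)} x
... | inj₁ k = h _ _ k (proj₂ (∧⁻ {B (true ∷ false ∷ q)} y))
-- Here 10p may have come from 01p in `A`. Since 01q survived in the shift of `B`, also 10q is in
-- `B`; 01p and 10q are disjoint on the two coordinates, so p meets q.
... | inj₂ k with h _ (true ∷ false ∷ q) k (proj₁ (∧⁻ y))
...   | inj₂ (inj₂ m) = inj₂ (inj₂ m)
Cross-shift zero A B h (false ∷ true ∷ p) (true ∷ false ∷ q) x y with ∨⁻ {B (true ∷ false ∷ q)} y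
... | inj₁ k = h _ _ (proj₂ (∧⁻ {A (true ∷ false ∷ p)} x)) k
... | inj₂ k with h (true ∷ false ∷ p) _ (proj₁ (∧⁻ x)) k
...   | inj₂ (inj₂ m) = inj₂ (inj₂ m)
Cross-shift zero A B h (true ∷ false ∷ p) (false ∷ false ∷ q) x y with ∨⁻ {A (true ∷ false ∷ p)} x
... | inj₁ k = h _ _ k y
... | inj₂ k with h _ (false ∷ false ∷ q) k y
...   | inj₂ (inj₂ m) = inj₂ (inj₂ m)
Cross-shift zero A B h (false ∷ false ∷ p) (true ∷ false ∷ q) x y with ∨⁻ {B (true ∷ false ∷ q)} y
... | inj₁ k = h _ _ x k
... | inj₂ k with h (false ∷ false ∷ p) _ x k
...   | inj₂ (inj₂ m) = inj₂ (inj₂ m)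
Cross-shift zero A B h (false ∷ true ∷ p) (false ∷ false ∷ q) x y =
  h _ _ (proj₂ (∧⁻ {A (true ∷ false ∷ p)} x)) y
Cross-shift zero A B h (false ∷ false ∷ p) (false ∷ true ∷ q) x y =
  h _ _ x (proj₂ (∧⁻ {B (true ∷ false ∷ q)} y))
Cross-shift (suc j) A B h [] [] x y = h [] [] x y
Cross-shift (suc j) A B h (true ∷ p) (true ∷ q) x y = inj₁ tt
Cross-shift (suc j) A B h (true ∷ p) (false ∷ q) x y =
  inj₂ (Cross-shift j (A ⊳ true) (B ⊳ false) (λ p q x y → [ (λ ()) , id ] (h _ _ x y)) p q x y)
Cross-shift (suc j) A B h (false ∷ p) (b ∷ q) x y =
  inj₂ (Cross-shift j (A ⊳ false) (B ⊳ b) (λ p q x y → [ (λ ()) , id ] (h _ _ x y)) p q x y)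

-- Badness under shifting, and termination of shifting.

Bad : ∀ {n} → Family n → Set
Bad A = size (∂ A) < size A

Bad-shift : ∀ {n} j (A : Family n) → Bad A → Bad (shift j A)
Bad-shift j A h = begin-strict
  size (∂ (shift j A)) ≤⟨ size-mono (∂ (shift j A)) (shift j (∂ A)) (∂-shift j A) ⟩
  size (shift j (∂ A)) ≡⟨ size-shift j (∂ A) ⟩
  size (∂ A)           <⟨ h ⟩
  size A               ≡⟨ size-shift j A ⟨
  size (shift j A)     ∎

-- The sum over the members p of A of the number with binary digits p, lowest
-- first: moving an element forward lowers it.
weight : ∀ {n} → Family n → ℕ
weight {zero}  A = 0
weight {suc n} A = 2 * (weight (A ⊳ true) + weight (A ⊳ false)) + size (A ⊳ true)

weight-∪∩ : ∀ {n} (A B : Family n) → weight (A ∪ᶠ B) + weight (A ∩ᶠ B) ≡ weight A + weight B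
weight-∪∩ {zero}  A B = refl
weight-∪∩ {suc n} A B = trans
  (lem (weight (A ⊳ true ∪ᶠ B ⊳ true)) (weight (A ⊳ false ∪ᶠ B ⊳ false)) (size (A ⊳ true ∪ᶠ B ⊳ true))
       (weight (A ⊳ true ∩ᶠ B ⊳ true)) (weight (A ⊳ false ∩ᶠ B ⊳ false)) (size (A ⊳ true ∩ᶠ B ⊳ true)))
  (trans (cong₂ _+_ (cong₂ (λ x y → 2 * (x + y)) (weight-∪∩ (A ⊳ true) (B ⊳ true))
                                                  (weight-∪∩ (A ⊳ false) (B ⊳ false)))
                    (size-∪∩ (A ⊳ true) (B ⊳ true)))
  (sym (lem (weight (A ⊳ true)) (weight (A ⊳ false)) (size (A ⊳ true))
            (weight (B ⊳ true)) (weight (B ⊳ false)) (size (B ⊳ true)))))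
  where
  lem : ∀ a b c a′ b′ c′ → (2 * (a + b) + c) + (2 * (a′ + b′) + c′) ≡ 2 * ((a + a′) + (b + b′)) + (c + c′)
  lem = solve-∀

-- Each set that moves changes its two lowest digits from 01 to 10, that is, its value drops from 2
-- to 1 there. The sets that move are those of 01p in `A` with 10p not in `A`; the equation is
-- written without subtraction.
weight-shift₀ : ∀ {n} (A : Family (suc (suc n))) →
  weight (shift 0 A) + size (A ⊳ false ⊳ true) ≡
  weight A + size (A ⊳ true ⊳ false ∩ᶠ A ⊳ false ⊳ true)
weight-shift₀ A = trans
  (lem (weight (A ⊳ true ⊳ true)) (weight (U ∪ᶠ V)) (weight (U ∩ᶠ V)) (weight (A ⊳ false ⊳ false))
       (size (A ⊳ true ⊳ true)) (size (U ∪ᶠ V)) (size (U ∩ᶠ V)) (size V))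
  (trans (cong₂ (λ x y → K + 4 * x + y + size (U ∩ᶠ V) + size V) (weight-∪∩ U V) (size-∪∩ U V))
  (lem′ (weight (A ⊳ true ⊳ true)) (weight U) (weight V) (weight (A ⊳ false ⊳ false))
       (size (A ⊳ true ⊳ true)) (size U) (size (U ∩ᶠ V)) (size V)))
  where
  U = A ⊳ true ⊳ false
  V = A ⊳ false ⊳ true
  K = 4 * weight (A ⊳ true ⊳ true) + 4 * weight (A ⊳ false ⊳ false) + 3 * size (A ⊳ true ⊳ true)
  lem : ∀ a b c d e f g h →
    (2 * ((2 * (a + b) + e) + (2 * (c + d) + g)) + (e + f)) + h ≡
    (4 * a + 4 * d + 3 * e) + 4 * (b + c) + (f + g) + g + h
  lem = solve-∀
  lem′ : ∀ a b c d e f g h →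
    (4 * a + 4 * d + 3 * e) + 4 * (b + c) + (f + h) + g + h ≡
    (2 * ((2 * (a + b) + e) + (2 * (c + d) + h)) + (e + f)) + g
  lem′ = solve-∀

weight-shift : ∀ {n} j (A : Family n) → weight (shift j A) ≤ weight A
weight-shift {zero}        zero    A = z≤n
weight-shift {suc zero}    zero    A = ≤-refl
weight-shift {suc (suc n)} zero    A = +-cancelʳ-≤ (size (A ⊳ false ⊳ true)) _ _ (begin
  weight (shift 0 A) + size (A ⊳ false ⊳ true)                  ≡⟨ weight-shift₀ A ⟩
  weight A + size (A ⊳ true ⊳ false ∩ᶠ A ⊳ false ⊳ true)         ≤⟨ +-monoʳ-≤ (weight A)
    (size-mono _ (A ⊳ false ⊳ true) (λ p → proj₂ ∘ ∧⁻ {A (true ∷ false ∷ p)})) ⟩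
  weight A + size (A ⊳ false ⊳ true)                             ∎)
weight-shift {zero}        (suc j) A = z≤n
weight-shift {suc n}       (suc j) A =
  +-mono-≤ (*-monoʳ-≤ 2 (+-mono-≤ (weight-shift j (A ⊳ true)) (weight-shift j (A ⊳ false))))
           (≤-reflexive (size-shift j (A ⊳ true)))

-- Shifted families.

Front : ∀ {n} → Family n → Set
Front {zero}        A = Unit.⊤
Front {suc zero}    A = Unit.⊤
Front {suc (suc n)} A = A ⊳ false ⊳ true ⊑ A ⊳ true ⊳ false

-- Only adjacent exchanges are demanded, one position at a time, after fixing all earlier
-- coordinates.
Shifted : ∀ {n} → Family n → Set
Shifted {zero}  A = Unit.⊤
Shifted {suc n} A = Front A × Shifted (A ⊳ true) × Shifted (A ⊳ false)

-- Failure of inclusion is given as a loss of size, which is exactly what `weight-shift₀` turns into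
-- a drop in weight.
⊑⊎∩< : ∀ {n} (A B : Family n) → A ⊑ B ⊎ size (B ∩ᶠ A) < size A
⊑⊎∩< {zero} A B with A [] in eqA | B [] in eqB
... | false | true  = inj₁ λ { [] a → subst T (sym eqB) tt }
... | true  | true  = inj₁ λ { [] a → subst T (sym eqB) tt }
... | false | false = inj₁ λ { [] a → contradiction (subst T eqA a) λ () }
... | true  | false = inj₂ (s≤s z≤n)
⊑⊎∩< {suc n} A B with ⊑⊎∩< (A ⊳ true) (B ⊳ true) | ⊑⊎∩< (A ⊳ false) (B ⊳ false)
... | inj₁ h | inj₁ k = inj₁ λ { (true ∷ p) → h p ; (false ∷ p) → k p }
... | inj₂ h | _      = inj₂ (+-mono-<-≤ h (size-mono (B ⊳ false ∩ᶠ A ⊳ false) _ (λ p → proj₂ ∘ ∧⁻ {B (false ∷ p)})))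
... | inj₁ _ | inj₂ k = inj₂ (+-mono-≤-< (size-mono (B ⊳ true ∩ᶠ A ⊳ true) _ (λ p → proj₂ ∘ ∧⁻ {B (true ∷ p)})) k)

front? : ∀ {n} (A : Family n) → Front A ⊎ weight (shift 0 A) < weight A
front? {zero}        A = inj₁ tt
front? {suc zero}    A = inj₁ tt
front? {suc (suc n)} A with ⊑⊎∩< (A ⊳ false ⊳ true) (A ⊳ true ⊳ false)
... | inj₁ h = inj₁ h
... | inj₂ h = inj₂ (+-cancelʳ-< (size (A ⊳ false ⊳ true)) _ _
                 (subst (_< weight A + size (A ⊳ false ⊳ true)) (sym (weight-shift₀ A))
                   (+-monoʳ-< (weight A) h)))

shifted? : ∀ {n} (A : Family n) → Shifted A ⊎ ∃ λ j → weight (shift j A) < weight A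
shifted? {zero}  A = inj₁ tt
shifted? {suc n} A with front? A | shifted? (A ⊳ true) | shifted? (A ⊳ false)
... | inj₁ f | inj₁ h       | inj₁ k       = inj₁ (f , h , k)
... | inj₂ f | _            | _            = inj₂ (0 , f)
... | _      | inj₂ (j , h) | _            = inj₂ (suc j ,
  +-mono-<-≤ (*-monoʳ-< 2 (+-mono-<-≤ h (weight-shift j (A ⊳ false)))) (≤-reflexive (size-shift j (A ⊳ true))))
... | _      | _            | inj₂ (j , h) = inj₂ (suc j ,
  +-mono-<-≤ (*-monoʳ-< 2 (+-mono-≤-< (weight-shift j (A ⊳ true)) h)) (≤-reflexive (size-shift j (A ⊳ true))))

-- In a member avoiding the first coordinate, any element may be exchanged for that coordinate: a
-- chain of adjacent exchanges has the same net effect.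
Shifted⇒∂⊑ : ∀ {n} (A : Family (suc n)) → Shifted A → ∂ (A ⊳ false) ⊑ A ⊳ true
Shifted⇒∂⊑ A (f , s₁ , s₀) (true ∷ p) h =
  Shifted⇒∂⊑ (A ⊳ true) s₁ p (∂-mono (A ⊳ false ⊳ true) (A ⊳ true ⊳ false) f p h)
Shifted⇒∂⊑ A (f , s₁ , s₀) (false ∷ p) h with ∨⁻ {A (false ∷ true ∷ p)} h
... | inj₁ k = f p k
... | inj₂ k = f p (Shifted⇒∂⊑ (A ⊳ false) s₀ p k)

-- Walks of members.

-- Read p as a walk going up at members and down at non-members: some member of
-- A has a walk that never reaches height l.
StaysBelow : ∀ {n} → ℕ → Family n → Set
StaysBelow         zero    A = Empty.⊥
StaysBelow {zero}  (suc l) A = T (A [])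
StaysBelow {suc n} (suc l) A = StaysBelow l (A ⊳ true) ⊎ StaysBelow (2 + l) (A ⊳ false)

StaysBelow-mono : ∀ {n} l (A B : Family n) → A ⊑ B → StaysBelow l A → StaysBelow l B
StaysBelow-mono {zero}  (suc l) A B h = h []
StaysBelow-mono {suc n} (suc l) A B h =
  Sum.map (StaysBelow-mono l _ _ (λ p → h (true ∷ p))) (StaysBelow-mono (2 + l) _ _ (λ p → h (false ∷ p)))

StaysBelow-suc : ∀ {n} l (A : Family n) → StaysBelow l A → StaysBelow (suc l) A
StaysBelow-suc {zero}  (suc l) A = id
StaysBelow-suc {suc n} (suc l) A =
  Sum.map (StaysBelow-suc l (A ⊳ true)) (StaysBelow-suc (2 + l) (A ⊳ false))

StaysBelow⇒∃ : ∀ {n} l (A : Family n) → StaysBelow l A → ∃ λ p → T (A p)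
StaysBelow⇒∃ {zero}  (suc l) A h = [] , h
StaysBelow⇒∃ {suc n} (suc l) A (inj₁ h) with StaysBelow⇒∃ l (A ⊳ true) h
... | p , x = true ∷ p , x
StaysBelow⇒∃ {suc n} (suc l) A (inj₂ h) with StaysBelow⇒∃ (2 + l) (A ⊳ false) h
... | p , x = false ∷ p , x

-- Deleting the first element of a nonempty member lowers the rest of its walk by two.
StaysBelow-∂ : ∀ {n} l (A B : Family n) → ∂ A ⊑ B → StaysBelow (3 + l) A →
  T (A ⊥) ⊎ StaysBelow (suc l) B
StaysBelow-∂ {zero}  l A B h s = inj₁ s
StaysBelow-∂ {suc n} l A B h (inj₁ s) =
  inj₂ (inj₂ (StaysBelow-mono (2 + l) (A ⊳ true) (B ⊳ false) (λ p x → h (false ∷ p) (∨⁺ (inj₁ x))) s))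
StaysBelow-∂ {suc n} l A B h (inj₂ s) =
  Sum.map id inj₂ (StaysBelow-∂ (suc l) (A ⊳ false) (B ⊳ false)
    (λ p x → h (false ∷ p) (∨⁺ {A (true ∷ p)} (inj₂ x))) s)

-- Disjoint members are built one coordinate at a time. A walk staying below 1 starts with a step
-- down, leaving bound 2; the other can be taken to start with a step up, leaving bound 1. The two
-- families then swap roles, which is why the bounds differ by one.
Shifted⇒¬Cross : ∀ {n} (A B : Family n) → Shifted A → Shifted B →
  StaysBelow 1 A → StaysBelow 2 B → ¬ Cross A B
Shifted⇒¬Cross {zero} A B _ _ x y h = h [] [] x y
Shifted⇒¬Cross {suc n} A B (_ , _ , sA) sB (inj₂ x) y h = [ front , back ] y
  where
  front : ¬ StaysBelow 1 (B ⊳ true)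
  front z = Shifted⇒¬Cross (B ⊳ true) (A ⊳ false) (proj₁ (proj₂ sB)) sA z x
    λ p q u v → [ (λ ()) , Meets-sym q p ] (h (false ∷ q) (true ∷ p) v u)
  back : ¬ StaysBelow 3 (B ⊳ false)
  -- If the member of `B` also avoids the first coordinate, either it is empty, and meets nothing,
  -- or its first element is exchanged for that coordinate, which brings the bound from 3 down to 1.
  back z with StaysBelow-∂ 0 (B ⊳ false) (B ⊳ true) (Shifted⇒∂⊑ B sB) z
  ... | inj₂ w = front w
  ... | inj₁ w with StaysBelow⇒∃ 2 (A ⊳ false) x
  ...   | p , u = ¬Meets-⊥ (false ∷ p) (h (false ∷ p) ⊥ u w)

-- Iterated shadows, and the impossibility of two bad cross-intersecting families.

∂^ : ∀ {n} → ℕ → Family n → Family n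
∂^ zero    A = A
∂^ (suc l) A = ∂ (∂^ l A)

∂^-mono : ∀ {n} l (A B : Family n) → A ⊑ B → ∂^ l A ⊑ ∂^ l B
∂^-mono zero    A B h = h
∂^-mono (suc l) A B h = ∂-mono (∂^ l A) (∂^ l B) (∂^-mono l A B h)

∂^-∂ : ∀ {n} l (A : Family n) → ∂^ l (∂ A) ≡ ∂^ (suc l) A
∂^-∂ zero    A = refl
∂^-∂ (suc l) A = cong ∂ (∂^-∂ l A)

∂^-⊳true : ∀ {n} l (A : Family (suc n)) → ∂^ l A ⊳ true ≡ ∂^ l (A ⊳ true)
∂^-⊳true zero    A = refl
∂^-⊳true (suc l) A = cong ∂ (∂^-⊳true l A)

-- The halves are compared crosswise. Members with the first coordinate lose it as one of the
-- deletions. For members without it, `2 + l` deletions are available, and by shiftedness one of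
-- them becomes an exchange into the first coordinate.
size≤size-∂^ : ∀ {n} l (A : Family n) → Shifted A → ¬ StaysBelow l A → size A ≤ size (∂^ l A)
size≤size-∂^ zero A s h = ≤-refl
size≤size-∂^ {zero} (suc l) A s h with A []
... | true  = contradiction tt h
... | false = z≤n
size≤size-∂^ {suc n} (suc l) A s@(_ , s₁ , s₀) h = begin
  size A₁ + size A₀                                         ≤⟨ +-mono-≤ step₁ step₀ ⟩
  size (∂^ (suc l) A ⊳ false) + size (∂^ (suc l) A ⊳ true)  ≡⟨ +-comm (size (∂^ (suc l) A ⊳ false)) _ ⟩
  size (∂^ (suc l) A)                                       ∎
  where
  A₁ = A ⊳ true
  A₀ = A ⊳ false
  step₁ : size A₁ ≤ size (∂^ (suc l) A ⊳ false)
  step₁ = begin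
    size A₁                     ≤⟨ size≤size-∂^ l A₁ s₁ (h ∘ inj₁) ⟩
    size (∂^ l A₁)              ≡⟨ cong size (∂^-⊳true l A) ⟨
    size (∂^ l A ⊳ true)        ≤⟨ size-mono (∂^ l A ⊳ true) (∂^ (suc l) A ⊳ false) (λ p → ∨⁺ ∘ inj₁) ⟩
    size (∂^ (suc l) A ⊳ false) ∎
  step₀ : size A₀ ≤ size (∂^ (suc l) A ⊳ true)
  step₀ = begin
    size A₀                     ≤⟨ size≤size-∂^ (2 + l) A₀ s₀ (h ∘ inj₂) ⟩
    size (∂^ (2 + l) A₀)        ≡⟨ cong size (∂^-∂ (suc l) A₀) ⟨
    size (∂^ (suc l) (∂ A₀))    ≤⟨ size-mono (∂^ (suc l) (∂ A₀)) (∂^ (suc l) A₁)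
                                     (∂^-mono (suc l) (∂ A₀) A₁ (Shifted⇒∂⊑ A s)) ⟩
    size (∂^ (suc l) A₁)        ≡⟨ cong size (∂^-⊳true (suc l) A) ⟨
    size (∂^ (suc l) A ⊳ true)  ∎

-- Both families undergo the same shift whenever either is not yet shifted, so the sum of the
-- weights strictly drops. Once both are shifted, badness supplies in each a walk staying below 1,
-- and one of the bounds is relaxed to 2.
Bad⇒¬Cross : ∀ {n} (A B : Family n) → Bad A → Bad B → ¬ Cross A B
Bad⇒¬Cross A B = go (suc (weight A + weight B)) A B ≤-refl
  where
  go : ∀ m {n} (A B : Family n) → weight A + weight B < m → Bad A → Bad B → ¬ Cross A B
  go (suc m) A B (s≤s w) a b h with shifted? A | shifted? B
  ... | inj₁ sA | inj₁ sB =
    <⇒≱ a (size≤size-∂^ 1 A sA λ x →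
      <⇒≱ b (size≤size-∂^ 1 B sB λ y →
        Shifted⇒¬Cross A B sA sB x (StaysBelow-suc 1 B y) h))
  ... | inj₂ (j , l) | _ =
    go m (shift j A) (shift j B) (<-≤-trans (+-mono-<-≤ l (weight-shift j B)) w)
      (Bad-shift j A a) (Bad-shift j B b) (Cross-shift j A B h)
  ... | _ | inj₂ (j , l) =
    go m (shift j A) (shift j B) (<-≤-trans (+-mono-≤-< (weight-shift j A) l) w)
      (Bad-shift j A a) (Bad-shift j B b) (Cross-shift j A B h)

-- Atoms and bad atoms.

-- A subset A of S is encoded by any vector with that trace on S: entries of A
-- outside S are ignored and come from p.
fill : ∀ {n} (S A : Subset n) → Subset ∣ ∁ S ∣ → Subset n
fill []          []      p       = []
fill (true  ∷ S) (a ∷ A) p       = a ∷ fill S A p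
fill (false ∷ S) (a ∷ A) (b ∷ p) = b ∷ fill S A p

∂-fill : ∀ {n} (F : Family n) (S A : Subset n) → ∂ (F ∘ fill S A) ⊑ shadowOff S F ∘ fill S A
∂-fill F []          []      []          = id
∂-fill F (true  ∷ S) (a ∷ A) p           = ∂-fill (F ⊳ a) S A p
∂-fill F (false ∷ S) (a ∷ A) (true ∷ p)  = ∂-fill (F ⊳ true) S A p
∂-fill F (false ∷ S) (a ∷ A) (false ∷ p) =
  ∨⁺ {F (true ∷ fill S A p)} ∘ Sum.map id (∂-fill (F ⊳ false) S A p) ∘ ∨⁻ {F (true ∷ fill S A p)}

S∩A⊆fill : ∀ {n} (S A : Subset n) p → S ∩ A ⊆ fill S A p
S∩A⊆fill (true  ∷ S) (a ∷ A) p       = s⊆s (S∩A⊆fill S A p)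
S∩A⊆fill (false ∷ S) (a ∷ A) (b ∷ p) = out⊆ (S∩A⊆fill S A p)

Nonempty∩⇒Meets : ∀ {n} (p q : Subset n) → Nonempty (p ∩ q) → Meets p q
Nonempty∩⇒Meets (true ∷ p) (true ∷ q) (zero , here)    = inj₁ tt
Nonempty∩⇒Meets (a ∷ p)    (b ∷ q)    (suc x , there m) = inj₂ (Nonempty∩⇒Meets p q (x , m))

Meets-fill : ∀ {n} (S A B : Subset n) p q → Empty (A ∩ (S ∩ B)) →
  Meets (fill S A p) (fill S B q) → Meets p q
Meets-fill [] [] [] [] [] e m = m
Meets-fill (true ∷ S) (true ∷ A) (true ∷ B) p q e (inj₁ m) = contradiction (zero , here) e
Meets-fill (true ∷ S) (a ∷ A) (b ∷ B) p q e (inj₂ m) = Meets-fill S A B p q (drop-∷-Empty e) m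
Meets-fill (false ∷ S) (a ∷ A) (b ∷ B) (c ∷ p) (d ∷ q) e m =
  Sum.map id (Meets-fill S A B p q (drop-∷-Empty e)) m

BadAtom : ∀ {n} → Family n → Subset n → Subset n → Set
BadAtom F S A = size (shadowOff S F ∘ fill S A) < size (F ∘ fill S A)

-- With disjoint traces on `S`, members of the two atoms can meet only outside `S`, so the two atoms
-- give bad cross-intersecting families on the complement of `S`.
BadAtom-meet : ∀ {n} (F : Family n) → Intersecting F → ∀ S A B →
  BadAtom F S A → BadAtom F S B → ¬ Empty (A ∩ (S ∩ B))
BadAtom-meet F int S A B a b e = Bad⇒¬Cross (F ∘ fill S A) (F ∘ fill S B) (bad A a) (bad B b)
  λ p q x y → Meets-fill S A B p q e (Nonempty∩⇒Meets _ _ (int _ _ x y))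
  where
  bad : ∀ X → BadAtom F S X → Bad (F ∘ fill S X)
  bad X = ≤-<-trans (size-mono (∂ (F ∘ fill S X)) (shadowOff S F ∘ fill S X) (∂-fill F S X))

-- Refining a bad atom to a larger set.

+-<-split : ∀ {a b c d} → a + b < c + d → a < c ⊎ b < d
+-<-split {a} {b} {c} {d} h with a <? c
... | yes l = inj₁ l
... | no ¬l with b <? d
...   | yes m = inj₂ m
...   | no ¬m = contradiction h (≤⇒≯ (+-mono-≤ (≮⇒≥ ¬l) (≮⇒≥ ¬m)))

both : ∀ {n} → (Subset (suc n) → ℕ) → Subset n → ℕ
both φ p = φ (true ∷ p) + φ (false ∷ p)

total-both : ∀ {n} (φ : Subset (suc n) → ℕ) (S A : Subset n) → total (both φ ∘ fill S A) ≡
  total (λ p → φ (true ∷ fill S A p)) + total (λ p → φ (false ∷ fill S A p))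
total-both φ S A = total-+ (λ p → φ (true ∷ fill S A p)) (λ p → φ (false ∷ fill S A p))

-- The sum over an atom of `R` is the sum over the atoms of `S` inside it, so a strict inequality
-- survives in one of them.
total-refine : ∀ {n} (φ ψ : Subset n → ℕ) (R S A : Subset n) → R ⊆ S →
  total (φ ∘ fill R A) < total (ψ ∘ fill R A) →
  ∃ λ B → R ∩ B ≡ R ∩ A × total (φ ∘ fill S B) < total (ψ ∘ fill S B)
total-refine φ ψ [] [] [] _ h = [] , refl , h
total-refine φ ψ (true ∷ R) (false ∷ S) A R⊆S h with () ← R⊆S here
total-refine φ ψ (true ∷ R) (true ∷ S) (a ∷ A) R⊆S h
  with B , e , l ← total-refine (φ ∘ (a ∷_)) (ψ ∘ (a ∷_)) R S A (drop-∷-⊆ R⊆S) h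
  = a ∷ B , cong (a ∷_) e , l
total-refine φ ψ (false ∷ R) (true ∷ S) (a ∷ A) R⊆S h with +-<-split h
... | inj₁ h₁ with B , e , l ← total-refine (φ ∘ (true ∷_)) (ψ ∘ (true ∷_)) R S A (drop-∷-⊆ R⊆S) h₁
    = true ∷ B , cong (false ∷_) e , l
... | inj₂ h₀ with B , e , l ← total-refine (φ ∘ (false ∷_)) (ψ ∘ (false ∷_)) R S A (drop-∷-⊆ R⊆S) h₀
    = false ∷ B , cong (false ∷_) e , l
-- A coordinate outside both sets stays free: its two values are summed and no choice is made.
total-refine φ ψ (false ∷ R) (false ∷ S) (a ∷ A) R⊆S h
  with B , e , l ← total-refine (both φ) (both ψ) R S A (drop-∷-⊆ R⊆S)
    (subst₂ _<_ (sym (total-both φ R A)) (sym (total-both ψ R A)) h)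
  = false ∷ B , cong (false ∷_) e , subst₂ _<_ (total-both φ S B) (total-both ψ S B) l

shadowOff-anti : ∀ {n} (F : Family n) (R S : Subset n) → R ⊆ S → shadowOff S F ⊑ shadowOff R F
shadowOff-anti F []          []          h []          = id
shadowOff-anti F (true ∷ R)  (false ∷ S) h p           with () ← h here
shadowOff-anti F (true ∷ R)  (true ∷ S)  h (b ∷ p)     = shadowOff-anti (F ⊳ b) R S (drop-∷-⊆ h) p
shadowOff-anti F (false ∷ R) (true ∷ S)  h (true ∷ p)  = shadowOff-anti (F ⊳ true) R S (drop-∷-⊆ h) p
shadowOff-anti F (false ∷ R) (true ∷ S)  h (false ∷ p) =
  ∨⁺ {F (true ∷ p)} ∘ inj₂ ∘ shadowOff-anti (F ⊳ false) R S (drop-∷-⊆ h) p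
shadowOff-anti F (false ∷ R) (false ∷ S) h (true ∷ p)  = shadowOff-anti (F ⊳ true) R S (drop-∷-⊆ h) p
shadowOff-anti F (false ∷ R) (false ∷ S) h (false ∷ p) =
  ∨⁺ {F (true ∷ p)} ∘ Sum.map id (shadowOff-anti (F ⊳ false) R S (drop-∷-⊆ h) p) ∘ ∨⁻ {F (true ∷ p)}

-- Removing elements only outside the larger set gives a smaller shadow, so the atom of `R` remains
-- bad for `shadowOff S` before it is split.
BadAtom-refine : ∀ {n} (F : Family n) (R S A : Subset n) → R ⊆ S → BadAtom F R A →
  ∃ λ B → R ∩ B ≡ R ∩ A × BadAtom F S B
BadAtom-refine F R S A R⊆S h = total-refine (bit ∘ shadowOff S F) (bit ∘ F) R S A R⊆S (≤-<-trans
  (size-mono (shadowOff S F ∘ fill R A) (shadowOff R F ∘ fill R A)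
    (λ p → shadowOff-anti F R S R⊆S (fill R A p))) h)

-- Growing bad atoms.

∣S∣≡∣S─A∣+∣S∩A∣ : ∀ {n} (S A : Subset n) → ∣ S ∣ ≡ ∣ S ─ A ∣ + ∣ S ∩ A ∣
∣S∣≡∣S─A∣+∣S∩A∣ []          []          = refl
∣S∣≡∣S─A∣+∣S∩A∣ (true ∷ S)  (true ∷ A)  = trans (cong suc (∣S∣≡∣S─A∣+∣S∩A∣ S A)) (sym (+-suc _ _))
∣S∣≡∣S─A∣+∣S∩A∣ (true ∷ S)  (false ∷ A) = cong suc (∣S∣≡∣S─A∣+∣S∩A∣ S A)
∣S∣≡∣S─A∣+∣S∩A∣ (false ∷ S) (true ∷ A)  = ∣S∣≡∣S─A∣+∣S∩A∣ S A
∣S∣≡∣S─A∣+∣S∩A∣ (false ∷ S) (false ∷ A) = ∣S∣≡∣S─A∣+∣S∩A∣ S A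

∣p∣>0⇒Nonempty : ∀ {n} (p : Subset n) → ∣ p ∣ > 0 → Nonempty p
∣p∣>0⇒Nonempty {n} p h with nonempty? p
... | yes x = x
... | no e  = contradiction (trans (cong ∣_∣ (Empty-unique e)) (∣⊥∣≡0 n)) (>⇒≢ h)

∣[S─A]∩B∣<∣S∩B∣ : ∀ {n} (S A B : Subset n) → Nonempty (A ∩ (S ∩ B)) → ∣ (S ─ A) ∩ B ∣ < ∣ S ∩ B ∣
∣[S─A]∩B∣<∣S∩B∣ S A B (x , m) with x∈p∩q⁻ A (S ∩ B) m
... | x∈A , x∈S∩B = p⊂q⇒∣p∣<∣q∣ (incl , x , x∈S∩B , x∉)
  where
  incl : (S ─ A) ∩ B ⊆ S ∩ B
  incl y with x∈p∩q⁻ (S ─ A) B y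
  ... | u , v = x∈p∩q⁺ (p─q⊆p S A u , v)
  x∉ : x ∉ (S ─ A) ∩ B
  x∉ y = ∉─ S A x∈A (proj₁ (x∈p∩q⁻ (S ─ A) B y))
    where
    ∉─ : ∀ {n} (S A : Subset n) {x} → x ∈ A → x ∉ S ─ A
    ∉─ (s ∷ S) (true ∷ A) here ()
    ∉─ (s ∷ S) (a ∷ A) (there i) (there j) = ∉─ S A i j

[1+n]C2 : ∀ n → suc n C 2 ≡ n + n C 2
[1+n]C2 n = trans (sym (nCk+nC[k+1]≡[n+1]C[k+1] n 1)) (cong (_+ n C 2) (nC1≡n n))

large-BadAtom : ∀ {n} (F : Family n) → Intersecting F → (∀ i → BadAtom F ⁅ i ⁆ ⁅ i ⁆) →
  ∀ j S → suc j C 2 < ∣ S ∣ → ∃ λ A → BadAtom F S A × suc j ≤ ∣ S ∩ A ∣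
large-BadAtom F int bad zero S h with ∣p∣>0⇒Nonempty S h
-- `suc j C 2` is 0 here, so `S` has a point `i`; the bad atom at `i`, refined to `S`, still
-- contains `i`.
... | i , i∈S with BadAtom-refine F ⁅ i ⁆ S ⁅ i ⁆ (λ x → subst (_∈ S) (sym (x∈⁅y⁆⇒x≡y i x)) i∈S) (bad i)
...   | A , e , a = A , a , subst (_≤ ∣ S ∩ A ∣) (∣⁅x⁆∣≡1 i) (p⊆q⇒∣p∣≤∣q∣ incl)
  where
  i∈A : i ∈ A
  i∈A = p∩q⊆q ⁅ i ⁆ A (subst (i ∈_) (sym e) (x∈p∩q⁺ (x∈⁅x⁆ i , x∈⁅x⁆ i)))
  incl : ⁅ i ⁆ ⊆ S ∩ A
  incl x = subst (_∈ S ∩ A) (sym (x∈⁅y⁆⇒x≡y i x)) (x∈p∩q⁺ (i∈S , i∈A))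
large-BadAtom F int bad (suc j) S h
  with A , a , l ← large-BadAtom F int bad j S
    (≤-<-trans (m≤n+m (suc j C 2) (suc j)) (subst (_< ∣ S ∣) ([1+n]C2 (suc j)) h))
  with suc (suc j) ≤? ∣ S ∩ A ∣
... | yes m = A , a , m
... | no ¬m
  -- The trace of `A` has at most `suc j` elements, so what is left of `S` is still large enough for
  -- the same `j`.
  with A′ , a′ , l′ ← large-BadAtom F int bad j (S ─ A) (+-cancelʳ-< (suc j) _ _ (begin-strict
    suc j C 2 + suc j              ≡⟨ +-comm (suc j C 2) (suc j) ⟩
    suc j + suc j C 2              ≡⟨ [1+n]C2 (suc j) ⟨
    suc (suc j) C 2                <⟨ h ⟩
    ∣ S ∣                          ≡⟨ ∣S∣≡∣S─A∣+∣S∩A∣ S A ⟩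
    ∣ S ─ A ∣ + ∣ S ∩ A ∣          ≤⟨ +-monoʳ-≤ ∣ S ─ A ∣ (≤-pred (≰⇒> ¬m)) ⟩
    ∣ S ─ A ∣ + suc j              ∎))
  with B , e , b ← BadAtom-refine F (S ─ A) S A′ (p─q⊆p S A) a′
  with nonempty? (A ∩ (S ∩ B))
-- `B` agrees with `A′` on `S ─ A`, which gives `suc j` elements, and a point of `A` gives one more.
...   | yes ne = B , b , ≤-trans (s≤s (subst (suc j ≤_) (cong ∣_∣ (sym e)) l′)) (∣[S─A]∩B∣<∣S∩B∣ S A B ne)
...   | no ¬ne = contradiction ¬ne (BadAtom-meet F int S A B a b)

total>0⇒∃ : ∀ {n} (F : Family n) → size F > 0 → ∃ λ p → T (F p)
total>0⇒∃ {zero} F h with F [] in eq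
... | true = [] , subst T (sym eq) tt
total>0⇒∃ {suc n} F h with +-<-split {0} {0} h
... | inj₁ k with p , x ← total>0⇒∃ (F ⊳ true) k = true ∷ p , x
... | inj₂ k with p , x ← total>0⇒∃ (F ⊳ false) k = false ∷ p , x

-- A bad atom is nonempty, and any of its members contains the trace.
BadAtom-size : ∀ {n k} (F : Family n) → Uniform k F → ∀ S A → BadAtom F S A → ∣ S ∩ A ∣ ≤ k
BadAtom-size F uni S A a with p , x ← total>0⇒∃ (F ∘ fill S A) (≤-<-trans z≤n a) =
  subst (∣ S ∩ A ∣ ≤_) (uni _ x) (p⊆q⇒∣p∣≤∣q∣ (S∩A⊆fill S A p))

-- Translation from the list-based cardinality, link and shadow.

length-filter-map : ∀ {n} (F : Family (suc n)) b (ps : List (Subset n)) →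
  length (filter (λ p → T? (F p)) (map (b ∷_) ps)) ≡ length (filter (λ p → T? (F (b ∷ p))) ps)
length-filter-map F b []       = refl
length-filter-map F b (p ∷ ps) with F (b ∷ p)
... | true  = cong suc (length-filter-map F b ps)
... | false = length-filter-map F b ps

card≡size : ∀ {n} (F : Family n) → card F ≡ size F
card≡size {zero} F with F []
... | true  = refl
... | false = refl
card≡size {suc n} F = trans
  (cong length (filter-++ (λ p → T? (F p)) (map (true ∷_) (allSubsets n)) _))
  (trans (length-++ (filter (λ p → T? (F p)) (map (true ∷_) (allSubsets n))))
    (cong₂ _+_ (trans (length-filter-map F true (allSubsets n)) (card≡size (F ⊳ true)))
               (trans (length-filter-map F false (allSubsets n)) (card≡size (F ⊳ false)))))

∈-allSubsets : ∀ {n} (p : Subset n) → p List.∈ allSubsets n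
∈-allSubsets []          = here refl
∈-allSubsets (true ∷ p)  = ∈-++⁺ˡ (∈-map⁺ (true ∷_) (∈-allSubsets p))
∈-allSubsets (false ∷ p) = ∈-++⁺ʳ _ (∈-map⁺ (false ∷_) (∈-allSubsets p))

link⁻ : ∀ {n} (F : Family n) i p → T (link F i p) → ∃ λ q → i ∈ q × T (F q) × p ≡ q - i
link⁻ {n} F i p h with satisfied (any⁻ (λ q → F q ∧ mem i q ∧ eqS p (q - i)) (allSubsets n) h)
... | q , x with ∧⁻ {F q} x
...   | y , z with ∧⁻ {mem i q} z
...     | u , v = q , toWitness u , y , toWitness v

removal⁺ : ∀ {n} (H : Family n) i q → i ∈ q → T (H q) → T (H q ∧ mem i q ∧ eqS (q - i) (q - i))
removal⁺ H i q i∈q x = ∧⁺ (x , ∧⁺ {mem i q} (fromWitness i∈q , fromWitness {a? = ≡-dec Bool._≟_ (q - i) (q - i)} refl))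

link⁺ : ∀ {n} (F : Family n) i q → i ∈ q → T (F q) → T (link F i (q - i))
link⁺ F i q i∈q x = any⁺ (λ r → F r ∧ mem i r ∧ eqS (q - i) (r - i))
  (List.lose (∈-allSubsets q) (removal⁺ F i q i∈q x))

shadow⁺ : ∀ {n} (H : Family n) i q → i ∈ q → T (H q) → T (shadow H (q - i))
shadow⁺ {n} H i q i∈q x = any⁺ (λ r → any (λ y → H r ∧ mem y r ∧ eqS (q - i) (r - y)) (allFin n))
  (List.lose (∈-allSubsets q) (any⁺ (λ y → H q ∧ mem y q ∧ eqS (q - i) (q - y))
    (List.lose (∈-allFin i) (removal⁺ H i q i∈q x))))

total-fill-⊥ : ∀ {n} (φ : Subset n → ℕ) → total (φ ∘ fill ⊥ ⊥) ≡ total φ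
total-fill-⊥ {zero}  φ = refl
total-fill-⊥ {suc n} φ = cong₂ _+_ (total-fill-⊥ (φ ∘ (true ∷_))) (total-fill-⊥ (φ ∘ (false ∷_)))

size-∅ : ∀ {n} (F : Family n) → (∀ p → ¬ T (F p)) → size F ≡ 0
size-∅ {zero}  F h with F [] in eq
... | true  = contradiction (subst T (sym eq) tt) (h [])
... | false = refl
size-∅ {suc n} F h = cong₂ _+_ (size-∅ (F ⊳ true) (h ∘ (true ∷_))) (size-∅ (F ⊳ false) (h ∘ (false ∷_)))

-- The reindexing by `fill ⁅ i ⁆ ⁅ i ⁆` runs through the sets containing `i`, on which deletion of
-- `i` is injective.
size-fill≤ : ∀ {n} (i : Fin n) (X Y : Family n) → (∀ p → i ∈ p → T (Y p) → T (X (p - i))) →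
  size (Y ∘ fill ⁅ i ⁆ ⁅ i ⁆) ≤ size X
size-fill≤ zero X Y h = begin
  size ((Y ⊳ true) ∘ fill ⊥ ⊥)      ≡⟨ total-fill-⊥ (bit ∘ (Y ⊳ true)) ⟩
  size (Y ⊳ true)                   ≤⟨ size-mono (Y ⊳ true) (X ⊳ false)
    (λ p y → subst (λ q → T (X (false ∷ q))) (p─⊥≡p p) (h (true ∷ p) here y)) ⟩
  size (X ⊳ false)                  ≤⟨ m≤n+m _ _ ⟩
  size (X ⊳ true) + size (X ⊳ false) ∎
size-fill≤ (suc i) X Y h = +-mono-≤
  (size-fill≤ i (X ⊳ true) (Y ⊳ true) (λ p m → h (true ∷ p) (there m)))
  (size-fill≤ i (X ⊳ false) (Y ⊳ false) (λ p m → h (false ∷ p) (there m)))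

size≤size-fill : ∀ {n} (i : Fin n) (X Y : Family n) →
  (∀ p → T (X p) → ∃ λ q → i ∈ q × T (Y q) × p ≡ q - i) → size X ≤ size (Y ∘ fill ⁅ i ⁆ ⁅ i ⁆)
size≤size-fill zero X Y h = begin
  size (X ⊳ true) + size (X ⊳ false)  ≡⟨ cong (_+ size (X ⊳ false)) (size-∅ (X ⊳ true) none) ⟩
  size (X ⊳ false)                    ≤⟨ size-mono (X ⊳ false) (Y ⊳ true) incl ⟩
  size (Y ⊳ true)                     ≡⟨ total-fill-⊥ (bit ∘ (Y ⊳ true)) ⟨
  size ((Y ⊳ true) ∘ fill ⊥ ⊥)        ∎
  where
  none : ∀ p → ¬ T (X (true ∷ p))
  none p x with h (true ∷ p) x
  ... | true ∷ q , here , _ , ()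
  incl : X ⊳ false ⊑ Y ⊳ true
  incl p x with h (false ∷ p) x
  ... | true ∷ q , here , y , e =
    subst (λ r → T (Y (true ∷ r))) (sym (trans (proj₂ (∷-injective e)) (p─⊥≡p q))) y
size≤size-fill (suc i) X Y h = +-mono-≤ (size≤size-fill i (X ⊳ true) (Y ⊳ true) (tail true))
                                        (size≤size-fill i (X ⊳ false) (Y ⊳ false) (tail false))
  where
  tail : ∀ b p → T (X (b ∷ p)) → ∃ λ q → i ∈ q × T (Y (b ∷ q)) × p ≡ q - i
  tail b p x with h (b ∷ p) x
  ... | c ∷ q , there m , y , refl = q , m , y , refl

shadowOff⁻ : ∀ {n} (S : Subset n) (F : Family n) p → T (shadowOff S F p) →
  ∃₂ λ x q → x ∉ S × x ∈ q × T (F q) × p ≡ q - x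
shadowOff⁻ []          F []      ()
shadowOff⁻ (true ∷ S) F (b ∷ p) h with shadowOff⁻ S (F ⊳ b) p h
... | x , q , x∉S , x∈q , y , e = suc x , b ∷ q , x∉S ∘ drop-there , there x∈q , y , cong (b ∷_) e
shadowOff⁻ (false ∷ S) F (true ∷ p) h with shadowOff⁻ S (F ⊳ true) p h
... | x , q , x∉S , x∈q , y , e = suc x , true ∷ q , x∉S ∘ drop-there , there x∈q , y , cong (true ∷_) e
shadowOff⁻ (false ∷ S) F (false ∷ p) h with ∨⁻ {F (true ∷ p)} h
... | inj₁ y = zero , true ∷ p , (λ ()) , here , y , cong (false ∷_) (sym (p─⊥≡p p))
... | inj₂ k with shadowOff⁻ S (F ⊳ false) p k
...   | x , q , x∉S , x∈q , y , e = suc x , false ∷ q , x∉S ∘ drop-there , there x∈q , y , cong (false ∷_) e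

-- Deleting `i` identifies the members containing `i` with the link, and carries the shadow off `i`
-- into the shadow of the link.
link-Bad⇒BadAtom : ∀ {n} (F : Family n) i → card (shadow (link F i)) < card (link F i) →
  BadAtom F ⁅ i ⁆ ⁅ i ⁆
link-Bad⇒BadAtom F i h = begin-strict
  size (shadowOff ⁅ i ⁆ F ∘ fill ⁅ i ⁆ ⁅ i ⁆) ≤⟨ size-fill≤ i (shadow (link F i)) (shadowOff ⁅ i ⁆ F) removal ⟩
  size (shadow (link F i))                    ≡⟨ card≡size (shadow (link F i)) ⟨
  card (shadow (link F i))                    <⟨ h ⟩
  card (link F i)                             ≡⟨ card≡size (link F i) ⟩
  size (link F i)                             ≤⟨ size≤size-fill i (link F i) F (link⁻ F i) ⟩
  size (F ∘ fill ⁅ i ⁆ ⁅ i ⁆)                 ∎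
  where
  removal : ∀ p → i ∈ p → T (shadowOff ⁅ i ⁆ F p) → T (shadow (link F i) (p - i))
  removal p i∈p s with shadowOff⁻ ⁅ i ⁆ F p s
  ... | x , q , x∉i , x∈q , y , refl =
    -- The deletions of `x` and `i` commute, and `x` differs from `i`, so it is still present after
    -- `i` is deleted.
    subst (T ∘ shadow (link F i)) (p─x─y≡p─y─x q i x)
      (shadow⁺ (link F i) x (q - i) (x∈p∧x∉q⇒x∈p─q x∈q x∉i) (link⁺ F i q (p─q⊆p q ⁅ x ⁆ i∈p) y))

theorem1p3 : (n k : ℕ) → 1 ≤ n → 1 ≤ k → n > (k + 1) C 2 →
    (𝓕 : Family n) → Uniform k 𝓕 → Intersecting 𝓕 →
    ∃ λ (i : Fin n) → card (shadow (link 𝓕 i)) ≥ card (link 𝓕 i)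
theorem1p3 n k _ _ n> 𝓕 uni int with Fin.any? (λ i → card (link 𝓕 i) ≤? card (shadow (link 𝓕 i)))
... | yes good = good
... | no none
  -- If no `i` works, every link is bad; on the whole ground set this yields a trace of at least
  -- `suc k` elements inside a member of size `k`.
  with A , a , l ← large-BadAtom 𝓕 int (λ i → link-Bad⇒BadAtom 𝓕 i (≰⇒> λ g → none (i , g))) k ⊤
    (subst₂ _<_ (cong (_C 2) (+-comm k 1)) (sym (∣⊤∣≡n n)) n>)
  = contradiction (BadAtom-size 𝓕 uni ⊤ A a) (<⇒≱ l)
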